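{- Let $0\le s\le n-3$. Then the graph $K_{n-s}^n(l_1,l_2,\ldots,l_{n-s})$ with $|l_i-l_j|\le 1$ for all $i,j\in\{1,2,\ldots,n-s\}$ has the minimum Wiener index over $\mathfrak{C}_{n,s}$, the set of all connected graphs on $n$ vertices with exactly $s$ cut vertices.
   Context: All graphs are finite, simple, connected and undirected. The Wiener index of a connected graph $G$ is $W(G)=\sum_{\{u,v\}\subseteq V(G)}d_G(u,v)$, where the sum is over unordered pairs of vertices and $d_G$ is the shortest-path distance. A vertex $v$ of $G$ is a cut vertex if $G\setminus v$ is disconnected. $\mathfrak{C}_{n,s}$ is the set of all connected graphs on $n$ vertices with exactly $s$ cut vertices. For $2\le m\le n$, let $v_1,\ldots,v_m$ be the vertices of the complete graph $K_m$, and let $l_1,\ldots,l_m$ be positive integers with $l_1+\cdots+l_m=n$. The graph $K_m^n(l_1,\ldots,l_m)$ on $n$ vertices is obtained by identifying, for each $i=1,\ldots,m$, an end vertex of the path $P_{l_i}$ on $l_i$ vertices with the vertex $v_i$ (when $l_i=1$ nothing is attached at $v_i$). -}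

module Defs where

open import Algebra.Properties.CommutativeMonoid.Sum as Sum using ()
open import Data.Bool.Base using (if_then_else_)
open import Data.Fin.Base using (Fin; zero; suc; toℕ)
open import Data.Fin.Permutation using (cast-id)
open import Data.Fin.Properties using (any?; +↔⊎) renaming (_≟_ to _≟ᶠ_; _<?_ to _<ᶠ?_)
open import Data.Fin.Subset as Subset using (Subset; _∈_)
open import Data.Nat.Base using (ℕ; zero; suc; _≤_; _<_; z≤n; ∣_-_∣)
open import Data.Nat.Properties using (_≟_; ≤-antisym; ≮⇒≥; m<1+n⇒m<n∨m≡n; ∣-∣-comm; ∣n-n∣≡0; 0≢1+n; +-0-commutativeMonoid)
open import Data.Product.Base using (Σ; Σ-syntax; ∃; ∃-syntax; _×_; _,_; proj₁; proj₂)
open import Data.Refinement using (Refinement-syntax; value)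
open import Data.Refinement.Properties using (value-injective)
open import Data.Sum.Base using (_⊎_; inj₁; inj₂)
open import Data.Sum.Function.Propositional using (_⊎-↔_)
open import Data.Vec.Functional using (Vector; tail)
open import Function.Base using (_∘_)
open import Function.Bundles using (_⇔_; _↔_; _↣_; Injection; mk↔ₛ′; mk↣)
open import Function.Construct.Identity using (↔-id)
open import Function.Properties.Inverse using (↔⇒↣; ↔-trans)
open import Level using (0ℓ)
open import Relation.Binary.Core using (Rel)
open import Relation.Binary.Definitions using (Decidable; Symmetric)
open import Relation.Binary.PropositionalEquality.Core using (_≡_; _≢_; refl; sym; trans; cong)
open import Relation.Nullary using (¬_; Dec; does; yes; no; contradiction)
open import Relation.Nullary.Decidable using (map′; _×-dec_)

open Sum +-0-commutativeMonoid public using (sum; sum-syntax)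

record Graph (V : Set) : Set₁ where
  infix 4 _~_ _~?_
  field
    _~_      : Rel V 0ℓ
    _~?_     : Decidable _~_
    ~-sym    : Symmetric _~_
    ~-irrefl : ∀ {v} → ¬ (v ~ v)

-- The subgraph induced on the image of an injection, with vertices named by U.
infixl 5 _↾_
_↾_ : ∀ {U V} → Graph V → U ↣ V → Graph U
G ↾ f = record
  { _~_      = λ u w → to u ~ to w
  ; _~?_     = λ u w → to u ~? to w
  ; ~-sym    = ~-sym
  ; ~-irrefl = ~-irrefl
  }
  where open Graph G
        open Injection f using (to)

infixl 5 _∖_
_∖_ : ∀ {V} → Graph V → (v : V) → Graph [ u ∈ V ∣ u ≢ v ]
G ∖ v = G ↾ mk↣ {to = value} value-injective

data Walk {V} (G : Graph V) : ℕ → Rel V 0ℓ where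
  stay : ∀ {v} → Walk G 0 v v
  step : ∀ {u v w k} → Graph._~_ G u v → Walk G k v w → Walk G (suc k) u w

Connected : ∀ {V} → Graph V → Set
Connected G = ∀ u v → ∃[ k ] Walk G k u v

IsCutVertex : ∀ {V} → Graph V → V → Set
IsCutVertex G v = ¬ Connected (G ∖ v)

-- Distance may be measured with walks instead of paths, since a shortest walk
-- repeats no vertex.
IsDistance : ∀ {V} → Graph V → V → V → ℕ → Set
IsDistance G u v d = Walk G d u v × (∀ {k} → Walk G k u v → d ≤ k)

distance-unique : ∀ {V} (G : Graph V) {u v d e} →
                  IsDistance G u v d → IsDistance G u v e → d ≡ e
distance-unique G (p , d≤) (q , e≤) = ≤-antisym (d≤ q) (e≤ p)

walk? : ∀ {n} (G : Graph (Fin n)) k → Decidable (Walk G k)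
walk? G zero    u v = map′ (λ { refl → stay }) (λ { stay → refl }) (u ≟ᶠ v)
walk? G (suc k) u v =
  map′ (λ { (_ , e , p) → step e p }) (λ { (step e p) → _ , e , p })
       (any? λ w → (u ~? w) ×-dec walk? G k w v)
  where open Graph G

private
  Minimum : (ℕ → Set) → ℕ → Set
  Minimum P d = P d × (∀ {k} → P k → d ≤ k)

  search : ∀ {P : ℕ → Set} → (∀ k → Dec (P k)) →
           ∀ b → ∃ (Minimum P) ⊎ (∀ {k} → k < b → ¬ P k)
  search P? zero = inj₂ λ ()
  search P? (suc b) with search P? b | P? b
  ... | inj₁ m    | _     = inj₁ m
  ... | inj₂ none | yes p = inj₁ (b , p , λ q → ≮⇒≥ λ k<b → none k<b q)
  ... | inj₂ none | no ¬p = inj₂ λ k<1+b q → below k<1+b q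
    where
    below : ∀ {k} → k < suc b → ¬ _
    below k<1+b q with m<1+n⇒m<n∨m≡n k<1+b
    ... | inj₁ k<b  = none k<b q
    ... | inj₂ refl = ¬p q

  minimum : ∀ {P : ℕ → Set} → (∀ k → Dec (P k)) → ∃ P → ∃ (Minimum P)
  minimum P? (b , p) with search P? b
  ... | inj₁ m    = m
  ... | inj₂ none = b , p , λ q → ≮⇒≥ λ k<b → none k<b q

distance : ∀ {n} (G : Graph (Fin n)) → Connected G → ∀ u v → ∃ (IsDistance G u v)
distance G conn u v = minimum (λ k → walk? G k u v) (conn u v)

-- Each unordered pair of distinct vertices is counted once, as u < v.  By
-- distance-unique the value does not depend on the proof of connectedness.
wienerIndex : ∀ {n} (G : Graph (Fin n)) → Connected G → ℕ
wienerIndex {n} G conn =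
  ∑[ u < n ] ∑[ v < n ]
    (if does (u <ᶠ? v) then proj₁ (distance G conn u v) else 0)

-- Membership of a graph in ℭ_{n,s}.
record _∈ℭ_ {n} (G : Graph (Fin n)) (s : ℕ) : Set where
  field
    connected       : Connected G
    cutVertices     : Subset n
    cutVertices-def : ∀ v → v ∈ cutVertices ⇔ IsCutVertex G v
    #cutVertices    : Subset.∣ cutVertices ∣ ≡ s

-- Vertex (i , a) is the a-th vertex of the path P_{l i}; its end (i , 0) is
-- the vertex v_i of the complete graph.
PathVertex : ∀ {m} → Vector ℕ m → Set
PathVertex {m} l = Σ[ i ∈ Fin m ] Fin (l i)

data PathAdj {m} (l : Vector ℕ m) : Rel (PathVertex l) 0ℓ where
  clique : ∀ {i j a b} → i ≢ j → toℕ a ≡ 0 → toℕ b ≡ 0 → PathAdj l (i , a) (j , b)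
  path   : ∀ {i a b} → ∣ toℕ a - toℕ b ∣ ≡ 1 → PathAdj l (i , a) (i , b)

cliqueWithPaths : ∀ {m} (l : Vector ℕ m) → Graph (PathVertex l)
cliqueWithPaths l = record
  { _~_      = PathAdj l
  ; _~?_     = adj?
  ; ~-sym    = λ { (clique i≢j a≡0 b≡0) → clique (i≢j ∘ sym) b≡0 a≡0
                 ; (path {a = a} {b} e) → path (trans (∣-∣-comm (toℕ b) (toℕ a)) e) }
  ; ~-irrefl = λ { (clique i≢i _ _) → i≢i refl
                 ; (path {a = a} e) → 0≢1+n (trans (sym (∣n-n∣≡0 (toℕ a))) e) }
  }
  where
  adj? : Decidable (PathAdj l)
  adj? (i , a) (j , b) with i ≟ᶠ j
  ... | yes refl = map′ path (λ { (path e) → e ; (clique i≢i _ _) → contradiction refl i≢i })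
                        (∣ toℕ a - toℕ b ∣ ≟ 1)
  ... | no i≢j   = map′ (λ { (p , q) → clique i≢j p q })
                        (λ { (clique _ p q) → p , q ; (path _) → contradiction refl i≢j })
                        ((toℕ a ≟ 0) ×-dec (toℕ b ≟ 0))

-- Numbers the vertices path by path.
locate : ∀ {m} (l : Vector ℕ m) → Fin (sum l) ↔ PathVertex l
locate {zero}  l = mk↔ₛ′ (λ ()) (λ ()) (λ ()) (λ ())
locate {suc m} l = ↔-trans +↔⊎ (↔-trans (↔-id _ ⊎-↔ locate (tail l)) cons)
  where
  cons : (Fin (l zero) ⊎ PathVertex (tail l)) ↔ PathVertex l
  cons = mk↔ₛ′
    (λ { (inj₁ a) → zero , a ; (inj₂ (i , a)) → suc i , a })
    (λ { (zero , a) → inj₁ a ; (suc i , a) → inj₂ (i , a) })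
    (λ { (zero , a) → refl ; (suc i , a) → refl })
    (λ { (inj₁ a) → refl ; (inj₂ (i , a)) → refl })

-- K_m^n(l_1,…,l_m); the l_i are meant to be positive.
K : ∀ {m} n (l : Vector ℕ m) → sum l ≡ n → Graph (Fin n)
K n l Σl≡n = cliqueWithPaths l ↾ ↔⇒↣ (↔-trans (cast-id (sym Σl≡n)) (locate l))

{-# OPTIONS --safe #-}
-- Attach to every vertex w a union A w of components of G ∖ w. A shortest
-- u-v path passes through every w separating u from v, so counting pairs gives
-- W(G) ≥ C(n,2) + Σ_w f(|A w|) with f x = x (n - 1 - x). For K_m^n(l), with A w
-- the part of the path beyond w, equality holds and the sum is
-- Σ_i Σ_{a < l i} f a.
-- In G take A w of minimum size for cut vertices w and empty otherwise. Then
-- 2|A w| ≤ n - 1, a range on which f increases, and A w contains a non-cut vertex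
-- r w (r w = w if w is not a cut vertex). If r w = r w′ and |A w| = |A w′|, then
-- w = w′: otherwise A w and A w′ would coincide or cover the graph. Hence every
-- size occurs at most m = n - s times. With q the least l i, f x is at least
-- f q minus the deficit f q ∸ f x, and each deficit at x < q is paid at most m
-- times in G but exactly m times in K_m^n(l).
module Submission where

open import Defs
open import Algebra.Properties.CommutativeMonoid.Sum as CMSum using ()
open import Algebra.Properties.Semiring.Sum as SemiringSum using ()
open import Data.Bool.Base using (true; false; if_then_else_)
open import Data.Fin using (Fin; zero; suc; toℕ; fromℕ<; _↑ˡ_; _↑ʳ_)
open import Data.Fin.Permutation using (cast-id; reverse)
open import Data.Fin.Properties using (any?; all?; cast-is-id; opposite-prop; sequence; splitAt-↑ˡ; splitAt-↑ʳ; toℕ<n; toℕ-fromℕ<; toℕ-injective)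
  renaming (_≟_ to _≟ᶠ_; _<?_ to _<ᶠ?_; suc-injective to sucᶠ-injective)
open import Data.Fin.Subset as Subset using (Subset; _∈_; _∉_)
open import Data.Fin.Subset.Properties using (_∈?_; anySubset?; nonempty?; ∉⊥; ∣⊥∣≡0; ∣∁p∣≡n∸∣p∣; p∩q⊆p; p⊂q⇒∣p∣<∣q∣; x∈p∩q⁺; x∈p∩q⁻; x∉p⇒x∈∁p)
open import Data.Empty.Irrelevant using ()
  renaming (⊥-elim to ⊥-elim-irr)
open import Data.Irrelevant using ()
  renaming ([_] to irr)
open import Data.Nat
open import Data.Nat.Induction using (Acc; acc; <-wellFounded)
open import Data.Nat.Properties hiding (_≟_; _≤?_; _<?_)
open import Data.Nat.Solver using (module +-*-Solver)
open import Data.Product using (Σ-syntax; ∃; ∃-syntax; _×_; _,_; proj₁; proj₂)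
open import Data.Refinement using (value)
  renaming (_,_ to _⟨,⟩_)
open import Data.Sum using (_⊎_; inj₁; inj₂)
open import Data.Vec as Vec using ([]; _∷_)
open import Data.Vec.Base using (here; there)
open import Data.Vec.Functional using (Vector)
open import Data.Vec.Properties using (lookup⇒[]=; []=⇒lookup; lookup∘tabulate)
open import Effect.Monad using (RawMonad)
open import Function using (_∘_; case_of_; _↔_; mk⇔; Equivalence; Injection; Inverse)
open import Function.Properties.Inverse using (↔-trans; ↔⇒↣)
open import Level using (0ℓ)
open import Relation.Binary.PropositionalEquality using (_≡_; _≢_; refl; sym; trans; cong; cong₂; subst; module ≡-Reasoning)
open import Relation.Nullary using (¬_; Dec; does; yes; no; contradiction)
open import Relation.Nullary.Decidable using (map′; _×-dec_; _→-dec_; ¬?; dec-true; dec-false; decidable-stable; ¬¬-excluded-middle)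
open import Relation.Nullary.Negation using (¬¬-Monad)
open import Relation.Unary using (Pred; Decidable)

open CMSum +-0-commutativeMonoid using (sum-cong-≗; ∑-distrib-+; ∑-comm; sum-permute)
open SemiringSum +-*-semiring using (*-distribˡ-sum; *-distribʳ-sum)

-- Finite sums and indicator functions.

∑-mono-≤ : ∀ {n} {f g : Vector ℕ n} → (∀ i → f i ≤ g i) → sum f ≤ sum g
∑-mono-≤ {zero}  f≤g = z≤n
∑-mono-≤ {suc n} f≤g = +-mono-≤ (f≤g zero) (∑-mono-≤ (f≤g ∘ suc))

∑-const : ∀ n c → ∑[ i < n ] c ≡ n * c
∑-const zero    c = refl
∑-const (suc n) c = cong (c +_) (∑-const n c)

∑-mono-< : ∀ {n} {f g : Vector ℕ n} → (∀ i → f i ≤ g i) → ∀ i → f i < g i → sum f < sum g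
∑-mono-< f≤g zero    f<g = +-mono-<-≤ f<g (∑-mono-≤ (f≤g ∘ suc))
∑-mono-< f≤g (suc i) f<g = +-mono-≤-< (f≤g zero) (∑-mono-< (f≤g ∘ suc) i f<g)

-- Meant for one step of a walk: only the term of the vertex stepped onto may drop, by at most one,
-- and the edge pays for it.
∑-mono-≤-except : ∀ {n} {f g : Vector ℕ n} i → f i ≤ 1 → (∀ j → j ≢ i → f j ≤ g j) →
                  sum f ≤ suc (sum g)
∑-mono-≤-except {g = g} zero    fi≤1 f≤g =
  +-mono-≤ fi≤1 (≤-trans (∑-mono-≤ λ j → f≤g (suc j) λ ()) (m≤n+m _ (g zero)))
∑-mono-≤-except {g = g} (suc i) fi≤1 f≤g =
  ≤-trans (+-mono-≤ (f≤g zero λ ()) (∑-mono-≤-except i fi≤1 λ j j≢i → f≤g (suc j) λ { refl → j≢i refl }))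
          (≤-reflexive (+-suc (g zero) _))

ind : {P : Set} → Dec P → ℕ
ind P? = if does P? then 1 else 0

ind-true : ∀ {P} (P? : Dec P) → P → ind P? ≡ 1
ind-true P? p = cong (if_then 1 else 0) (dec-true P? p)

ind-false : ∀ {P} (P? : Dec P) → ¬ P → ind P? ≡ 0
ind-false P? ¬p = cong (if_then 1 else 0) (dec-false P? ¬p)

ind-mono : ∀ {P Q} (P? : Dec P) (Q? : Dec Q) → (P → Q) → ind P? ≤ ind Q?
ind-mono (yes p) Q? f = ≤-reflexive (sym (ind-true Q? (f p)))
ind-mono (no  _) Q? f = z≤n

ind-cong : ∀ {P Q} (P? : Dec P) (Q? : Dec Q) → (P → Q) → (Q → P) → ind P? ≡ ind Q?
ind-cong P? Q? f g = ≤-antisym (ind-mono P? Q? f) (ind-mono Q? P? g)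

ind-× : ∀ {P Q} (P? : Dec P) (Q? : Dec Q) → ind (P? ×-dec Q?) ≡ ind P? * ind Q?
ind-× (yes _) Q? = sym (+-identityʳ (ind Q?))
ind-× (no  _) Q? = refl

ind-+-exclusive : ∀ {P Q} (P? : Dec P) (Q? : Dec Q) → (P → ¬ Q) → ind P? + ind Q? ≤ 1
ind-+-exclusive (no  _) (no  _) ¬pq = z≤n
ind-+-exclusive (no  _) (yes _) ¬pq = ≤-refl
ind-+-exclusive (yes _) (no  _) ¬pq = ≤-refl
ind-+-exclusive (yes p) (yes q) ¬pq = contradiction q (¬pq p)

∑-ind-empty : ∀ {n} {P : Pred (Fin n) 0ℓ} (P? : Decidable P) → (∀ i → ¬ P i) →
              ∑[ i < n ] ind (P? i) ≡ 0
∑-ind-empty {n} P? ¬P =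
  trans (sum-cong-≗ λ i → ind-false (P? i) (¬P i)) (trans (∑-const n 0) (*-zeroʳ n))

∑-ind-unique : ∀ {n} {P : Pred (Fin n) 0ℓ} (P? : Decidable P) →
               (∀ {i j} → P i → P j → i ≡ j) → ∑[ i < n ] ind (P? i) ≤ 1
∑-ind-unique {zero}  P? unique = z≤n
∑-ind-unique {suc n} P? unique with P? zero
... | no  _  = ∑-ind-unique (P? ∘ suc) λ p q → sucᶠ-injective (unique p q)
... | yes p₀ = ≤-reflexive (cong suc (∑-ind-empty (P? ∘ suc) λ i p → case unique p₀ p of λ ()))

∑-select : ∀ {n} j (f : Vector ℕ n) → ∑[ i < n ] (ind (j ≟ᶠ i) * f i) ≡ f j
∑-select {suc n} zero    f = trans (cong₂ _+_ (+-identityʳ (f zero)) (trans (∑-const n 0) (*-zeroʳ n))) (+-identityʳ (f zero))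
∑-select {suc n} (suc j) f =
  trans (sum-cong-≗ λ i → cong (_* f (suc i)) (ind-cong (suc j ≟ᶠ suc i) (j ≟ᶠ i) (λ { refl → refl }) (cong suc)))
        (∑-select j (f ∘ suc))

∑-reverse : ∀ n (f : ℕ → ℕ) → ∑[ i < n ] f (n ∸ suc (toℕ i)) ≡ ∑[ i < n ] f (toℕ i)
∑-reverse n f = sym (trans (sum-permute (f ∘ toℕ) (reverse {n}))
                           (sum-cong-≗ {n} λ i → cong f (opposite-prop i)))

∑-extend : ∀ {m n} (f : ℕ → ℕ) → m ≤ n → ∑[ i < m ] f (toℕ i) ≤ ∑[ i < n ] f (toℕ i)
∑-extend f z≤n       = z≤n
∑-extend f (s≤s m≤n) = +-monoʳ-≤ (f 0) (∑-extend (f ∘ suc) m≤n)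

∑-product : ∀ {m n} (f : Vector ℕ m) (g : Vector ℕ n) →
            ∑[ i < m ] ∑[ j < n ] (f i * g j) ≡ sum f * sum g
∑-product f g =
  trans (sum-cong-≗ λ i → sym (*-distribˡ-sum (f i) g)) (sym (*-distribʳ-sum (sum g) f))

∑-< : ∀ n → (Fin n → Fin n → ℕ) → ℕ
∑-< n g = ∑[ u < n ] ∑[ v < n ] (if does (u <ᶠ? v) then g u v else 0)

∑-<-mono : ∀ {n} {g h : Fin n → Fin n → ℕ} → (∀ {u v} → u ≢ v → g u v ≤ h u v) → ∑-< n g ≤ ∑-< n h
∑-<-mono {g = g} {h} g≤h = ∑-mono-≤ λ u → ∑-mono-≤ λ v → term (u <ᶠ? v)
  where
  term : ∀ {u v : Fin _} (d : Dec (toℕ u < toℕ v)) → (if does d then g u v else 0) ≤ (if does d then h u v else 0)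
  term (yes u<v) = g≤h λ { refl → <-irrefl refl u<v }
  term (no  _)   = z≤n

∑-<-+ : ∀ {n} (g h : Fin n → Fin n → ℕ) → ∑-< n (λ u v → g u v + h u v) ≡ ∑-< n g + ∑-< n h
∑-<-+ {n} g h = trans (sum-cong-≗ λ u → trans (sum-cong-≗ {n} λ v → term (does (u <ᶠ? v)))
                                              (∑-distrib-+ {n} _ (λ v → if does (u <ᶠ? v) then h u v else 0)))
                      (∑-distrib-+ {n} _ (λ u → ∑[ v < n ] (if does (u <ᶠ? v) then h u v else 0)))
  where
  term : ∀ b {x y} → (if b then x + y else 0) ≡ (if b then x else 0) + (if b then y else 0)
  term true  = refl
  term false = refl

-- Transposing the terms `g v u` over `u < v` gives the half of the square below the diagonal; the
-- diagonal contributes nothing.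
∑-<-symmetrize : ∀ {n} (g : Fin n → Fin n → ℕ) → (∀ u → g u u ≡ 0) →
                 ∑-< n (λ u v → g u v + g v u) ≡ ∑[ u < n ] ∑[ v < n ] g u v
∑-<-symmetrize {n} g guu≡0 = begin
  ∑-< n (λ u v → g u v + g v u)
    ≡⟨ ∑-<-+ g (λ u v → g v u) ⟩
  ∑-< n g + ∑[ u < n ] ∑[ v < n ] lower u v
    ≡⟨ cong (∑-< n g +_) (∑-comm lower) ⟩
  ∑-< n g + ∑[ v < n ] ∑[ u < n ] lower u v
    ≡⟨ ∑-distrib-+ (λ u → ∑[ v < n ] upper u v) _ ⟨
  ∑[ u < n ] (∑[ v < n ] upper u v + ∑[ v < n ] lower v u)
    ≡⟨ sum-cong-≗ (λ u → ∑-distrib-+ (upper u) (λ v → lower v u)) ⟨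
  ∑[ u < n ] ∑[ v < n ] (upper u v + lower v u)
    ≡⟨ sum-cong-≗ (λ u → sum-cong-≗ λ v → term (u <ᶠ? v) (v <ᶠ? u)) ⟩
  ∑[ u < n ] ∑[ v < n ] g u v ∎
  where
  open ≡-Reasoning
  upper lower : Fin n → Fin n → ℕ
  upper u v = if does (u <ᶠ? v) then g u v else 0
  lower u v = if does (u <ᶠ? v) then g v u else 0
  term : ∀ {u v : Fin n} (d : Dec (toℕ u < toℕ v)) (e : Dec (toℕ v < toℕ u)) →
         (if does d then g u v else 0) + (if does e then g u v else 0) ≡ g u v
  term (yes u<v) (yes v<u) = contradiction v<u (<-asym u<v)
  term (yes _)   (no  _)   = +-identityʳ _
  term (no  _)   (yes _)   = refl
  term {u} {v} (no u≮v) (no v≮u) with toℕ-injective {i = u} {v} (≤-antisym (≮⇒≥ v≮u) (≮⇒≥ u≮v))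
  ... | refl = sym (guu≡0 u)

-- Subsets cut out by decidable predicates.

subset : ∀ {n} {P : Pred (Fin n) 0ℓ} → Decidable P → Subset n
subset P? = Vec.tabulate (does ∘ P?)

∈-subset⁺ : ∀ {n} {P : Pred (Fin n) 0ℓ} (P? : Decidable P) {x} → P x → x ∈ subset P?
∈-subset⁺ P? {x} p = lookup⇒[]= x _ (trans (lookup∘tabulate _ x) (dec-true (P? x) p))

∈-subset⁻ : ∀ {n} {P : Pred (Fin n) 0ℓ} (P? : Decidable P) {x} → x ∈ subset P? → P x
∈-subset⁻ P? {x} x∈ with P? x in eq
... | yes p = p
... | no ¬p = case trans (sym ([]=⇒lookup x∈)) (trans (lookup∘tabulate _ x) (cong does eq)) of λ ()

∣p∣≡∑ind : ∀ {n} (p : Subset n) → Subset.∣ p ∣ ≡ ∑[ x < n ] ind (x ∈? p)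
∣p∣≡∑ind [] = refl
∣p∣≡∑ind (true  ∷ p) = cong suc (trans (∣p∣≡∑ind p) (sum-cong-≗ λ x → ind-cong (x ∈? p) (suc x ∈? true ∷ p) there λ { (there q) → q }))
∣p∣≡∑ind (false ∷ p) = trans (∣p∣≡∑ind p) (sum-cong-≗ λ x → ind-cong (x ∈? p) (suc x ∈? false ∷ p) there λ { (there q) → q })

∣subset∣ : ∀ {n} {P : Pred (Fin n) 0ℓ} (P? : Decidable P) → Subset.∣ subset P? ∣ ≡ ∑[ x < n ] ind (P? x)
∣subset∣ P? = trans (∣p∣≡∑ind (subset P?)) (sum-cong-≗ λ x → ind-cong (x ∈? subset P?) (P? x) (∈-subset⁻ P?) (∈-subset⁺ P?))

-- Pairs separated by a vertex.

Outside : ∀ {n} → Fin n → Subset n → Fin n → Set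
Outside w S v = v ∉ S × w ≢ v

outside? : ∀ {n} (w : Fin n) S → Decidable (Outside w S)
outside? w S v = ¬? (v ∈? S) ×-dec ¬? (w ≟ᶠ v)

-- `S`, `w` and the vertices outside partition the vertex set; in the proof `ind (w ≟ᶠ v) * 1`
-- counts `w` itself.
∣rest∣ : ∀ {n} {w : Fin n} {S} → w ∉ S →
         ∑[ v < n ] ind (outside? w S v) ≡ n ∸ 1 ∸ Subset.∣ S ∣
∣rest∣ {n} {w} {S} w∉S = begin
  o                 ≡⟨ m+n∸n≡m o (suc a) ⟨
  o + suc a ∸ suc a ≡⟨ cong (_∸ suc a) total ⟩
  n ∸ suc a         ≡⟨ ∸-+-assoc n 1 a ⟨
  n ∸ 1 ∸ a ∎
  where
  open ≡-Reasoning
  a = Subset.∣ S ∣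
  o = ∑[ v < n ] ind (outside? w S v)
  term : ∀ v → ind (outside? w S v) + (ind (w ≟ᶠ v) * 1 + ind (v ∈? S)) ≡ 1
  term v with v ∈? S | w ≟ᶠ v
  ... | yes v∈ | yes refl = contradiction v∈ w∉S
  ... | yes _  | no  _    = refl
  ... | no  _  | yes _    = refl
  ... | no  _  | no  _    = refl
  total : o + suc a ≡ n
  total = begin
    o + suc a
      ≡⟨ cong₂ (λ x y → o + (x + y)) (sym (∑-select w (λ _ → 1))) (∣p∣≡∑ind S) ⟩
    o + (∑[ v < n ] (ind (w ≟ᶠ v) * 1) + ∑[ v < n ] ind (v ∈? S))
      ≡⟨ cong (o +_) (∑-distrib-+ _ (λ v → ind (v ∈? S))) ⟨
    o + ∑[ v < n ] (ind (w ≟ᶠ v) * 1 + ind (v ∈? S))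
      ≡⟨ ∑-distrib-+ (λ v → ind (outside? w S v)) _ ⟨
    ∑[ v < n ] (ind (outside? w S v) + (ind (w ≟ᶠ v) * 1 + ind (v ∈? S)))
      ≡⟨ sum-cong-≗ term ⟩
    ∑[ v < n ] 1
      ≡⟨ trans (∑-const n 1) (*-identityʳ n) ⟩
    n ∎

-- If A w is a union of components of G ∖ w, then w separates u and v exactly
-- when one of them lies in A w and the other lies outside it and is not w.
module Sides {n} (A : Fin n → Subset n) (w∉A : ∀ w → w ∉ A w) where

  Separates : Fin n → Fin n → Fin n → Set
  Separates w u v = u ∈ A w × Outside w (A w) v

  separates? : ∀ w u v → Dec (Separates w u v)
  separates? w u v = (u ∈? A w) ×-dec outside? w (A w) v

  -- `Separates` fixes which of the two vertices lies in `A w`. The two orders exclude each other,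
  -- so this is 0 or 1.
  crossing : Fin n → Fin n → Fin n → ℕ
  crossing w u v = ind (separates? w u v) + ind (separates? w v u)

  crossings : Fin n → Fin n → ℕ
  crossings u v = ∑[ w < n ] crossing w u v

  crossings-sym : ∀ u v → crossings u v ≡ crossings v u
  crossings-sym u v = sum-cong-≗ λ w → +-comm (ind (separates? w u v)) _

  crossing-self : ∀ {w u v} → w ≡ u ⊎ u ≡ v → crossing w u v ≡ 0
  crossing-self {w} {u} {v} (inj₁ refl) = cong₂ _+_ (ind-false (separates? w u v) λ (u∈ , _) → w∉A w u∈)
                                                    (ind-false (separates? w v u) λ (_ , _ , w≢w) → w≢w refl)
  crossing-self {w} {u} {v} (inj₂ refl) = cong₂ _+_ (ind-false (separates? w u v) λ (u∈ , u∉ , _) → u∉ u∈)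
                                                    (ind-false (separates? w v u) λ (u∈ , u∉ , _) → u∉ u∈)

  -- Double counting: passing to ordered pairs and summing over `w` last, the pairs separated by `w`
  -- form the product of `A w` and the vertices outside it.
  ∑-crossings : ∑-< n (λ u v → 1 + crossings u v) ≡
                ∑-< n (λ _ _ → 1) + ∑[ w < n ] (Subset.∣ A w ∣ * (n ∸ 1 ∸ Subset.∣ A w ∣))
  ∑-crossings = trans (∑-<-+ (λ _ _ → 1) crossings) (cong (∑-< n (λ _ _ → 1) +_) (begin
    ∑-< n crossings
      ≡⟨ sum-cong-≗ (λ u → sum-cong-≗ λ v → cong (λ x → if does (u <ᶠ? v) then x else 0)
           (∑-distrib-+ (λ w → ind (separates? w u v)) (λ w → ind (separates? w v u)))) ⟩
    ∑-< n (λ u v → separators u v + separators v u)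
      ≡⟨ ∑-<-symmetrize separators (λ u → ∑-ind-empty (λ w → separates? w u u) λ w (u∈ , u∉ , _) → u∉ u∈) ⟩
    ∑[ u < n ] ∑[ v < n ] separators u v
      ≡⟨ sum-cong-≗ (λ u → ∑-comm λ v w → ind (separates? w u v)) ⟩
    ∑[ u < n ] ∑[ w < n ] ∑[ v < n ] ind (separates? w u v)
      ≡⟨ ∑-comm (λ u w → ∑[ v < n ] ind (separates? w u v)) ⟩
    ∑[ w < n ] ∑[ u < n ] ∑[ v < n ] ind (separates? w u v)
      ≡⟨ sum-cong-≗ (λ w → sum-cong-≗ λ u → sum-cong-≗ λ v → ind-× (u ∈? A w) (outside? w (A w) v)) ⟩
    ∑[ w < n ] ∑[ u < n ] ∑[ v < n ] (ind (u ∈? A w) * ind (outside? w (A w) v))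
      ≡⟨ sum-cong-≗ (λ w → ∑-product (λ u → ind (u ∈? A w)) (λ v → ind (outside? w (A w) v))) ⟩
    ∑[ w < n ] (∑[ u < n ] ind (u ∈? A w) * ∑[ v < n ] ind (outside? w (A w) v))
      ≡⟨ sum-cong-≗ (λ w → cong₂ _*_ (sym (∣p∣≡∑ind (A w))) (∣rest∣ (w∉A w))) ⟩
    ∑[ w < n ] (Subset.∣ A w ∣ * (n ∸ 1 ∸ Subset.∣ A w ∣)) ∎))
    where
    open ≡-Reasoning
    separators : Fin n → Fin n → ℕ
    separators u v = ∑[ w < n ] ind (separates? w u v)

-- Sides of a cut vertex.

record Side {n} (G : Graph (Fin n)) (w : Fin n) (S : Subset n) : Set where
  constructor mkSide
  open Graph G
  field
    w∉S    : w ∉ S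
    closed : ∀ x y → x ∈ S → x ~ y → w ≢ y → y ∈ S
    inner  : ∃ (_∈ S)
    outer  : ∃ (Outside w S)

module _ {n} (G : Graph (Fin n)) where
  open Graph G
  open Side

  side? : ∀ w → Decidable (Side G w)
  side? w S = map′ (λ (a , b , c , d) → mkSide a b c d) (λ (mkSide a b c d) → a , b , c , d)
    (¬? (w ∈? S) ×-dec
     (all? λ x → all? λ y → (x ∈? S) →-dec (x ~? y) →-dec ¬? (w ≟ᶠ y) →-dec (y ∈? S)) ×-dec
     nonempty? S ×-dec any? (outside? w S))

  -- If `u` does not reach `v` in `G ∖ w`, the vertices that do reach `v` form a side. Reachability
  -- is not decided here, so the argument runs under a double negation, which `pull` moves past the
  -- finitely many vertices.
  ¬side⇒¬¬connected : ∀ w → ¬ ∃ (Side G w) → ¬ ¬ Connected (G ∖ w)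
  ¬side⇒¬¬connected w ¬side ¬conn =
    pull (λ u → pull λ v → joined u v) λ h → ¬conn λ (u ⟨,⟩ pu) (v ⟨,⟩ pv) → h u v pu pv
    where
    pull : ∀ {P : Fin n → Set} → (∀ i → ¬ ¬ P i) → ¬ ¬ (∀ i → P i)
    pull = sequence (RawMonad.rawApplicative ¬¬-Monad)

    Joined : Fin n → Fin n → Set
    Joined u v = ∀ pu pv → ∃[ k ] Walk (G ∖ w) k (u ⟨,⟩ pu) (v ⟨,⟩ pv)

    joined : ∀ u v → ¬ ¬ Joined u v
    joined u v with u ≟ᶠ w | v ≟ᶠ w
    ... | yes u≡w | _       = λ ¬j → ¬j λ { (irr u≢w) _ → ⊥-elim-irr (u≢w u≡w) }
    ... | no  _   | yes v≡w = λ ¬j → ¬j λ { _ (irr v≢w) → ⊥-elim-irr (v≢w v≡w) }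
    ... | no  u≢w | no  v≢w = λ ¬j → pull {P = λ x → Dec (Reach x)} (λ x → ¬¬-excluded-middle) λ reach? →
      ¬side (subset reach? , record
        { w∉S    = λ w∈ → case ∈-subset⁻ reach? w∈ of λ { (irr w≢w , _) → ⊥-elim-irr (w≢w refl) }
        ; closed = λ x y x∈ x~y w≢y → ∈-subset⁺ reach?
            (case ∈-subset⁻ reach? x∈ of λ { (_ , _ , p) → irr (w≢y ∘ sym) , _ , step (~-sym x~y) p })
        ; inner  = v , ∈-subset⁺ reach? (irr v≢w , 0 , stay)
        ; outer  = u , (λ u∈ → case ∈-subset⁻ reach? u∈ of λ { (_ , k , p) → ¬j λ _ _ → k , p }) , u≢w ∘ sym
        })
      where
      Reach : Fin n → Set
      Reach x = ∃ λ px → ∃[ k ] Walk (G ∖ w) k (x ⟨,⟩ px) (v ⟨,⟩ irr v≢w)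

  -- Searching all subsets decides whether a side exists, which removes the double negation.
  cut⇒side : ∀ {w} → IsCutVertex G w → ∃ (Side G w)
  cut⇒side {w} cut = decidable-stable (anySubset? (side? w)) λ ¬side → ¬side⇒¬¬connected w ¬side cut

  -- A walk in `G ∖ w` avoids `w` and so cannot leave `S`.
  side⇒cut : ∀ {w S} → Side G w S → IsCutVertex G w
  side⇒cut {w} {S} s conn =
    let x , x∈ = inner s ; y , y∉ , w≢y = outer s
    in y∉ (stays (proj₂ (conn (x ⟨,⟩ irr λ { refl → w∉S s x∈ }) (y ⟨,⟩ irr (w≢y ∘ sym)))) x∈)
    where
    stays : ∀ {k u v} → Walk (G ∖ w) k u v → value u ∈ S → value v ∈ S
    stays stay u∈ = u∈
    stays (step {v = _ ⟨,⟩ irr x≢w} e p) u∈ =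
      -- The proof that `x` differs from `w` is irrelevant, so it can only refute; decidability of
      -- membership recovers the conclusion.
      stays p (decidable-stable (_ ∈? S) λ x∉ → ⊥-elim-irr (x≢w (sym (decidable-stable (w ≟ᶠ _) λ w≢x → x∉ (closed s _ _ u∈ e w≢x)))))

  restOf : Fin n → Subset n → Subset n
  restOf w S = subset (outside? w S)

  -- If an edge led from the rest into `S`, its reverse would put the starting vertex into `S` by
  -- closedness.
  rest-side : ∀ {w S} → Side G w S → Side G w (restOf w S)
  rest-side {w} {S} s = record
    { w∉S    = λ w∈ → proj₂ (∈-subset⁻ (outside? w S) w∈) refl
    ; closed = λ x y x∈ x~y w≢y → let x∉S , w≢x = ∈-subset⁻ (outside? w S) x∈ in
        ∈-subset⁺ (outside? w S) ((λ y∈S → x∉S (closed s y x y∈S (~-sym x~y) w≢x)) , w≢y)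
    ; inner  = let y , o = outer s in y , ∈-subset⁺ (outside? w S) o
    ; outer  = let x , x∈S = inner s in
        x , (λ x∈ → proj₁ (∈-subset⁻ (outside? w S) x∈) x∈S) , λ { refl → w∉S s x∈S }
    }

  record MinimalSide (w : Fin n) (S : Subset n) : Set where
    field
      side    : Side G w S
      minimal : ∀ {S′} → Side G w S′ → Subset.∣ S ∣ ≤ Subset.∣ S′ ∣

    -- `restOf w S` is a side of `w` too, so `S` is not the larger of two parts that together have
    -- `n ∸ 1` vertices.
    twice≤ : Subset.∣ S ∣ + Subset.∣ S ∣ ≤ n ∸ 1
    twice≤ = begin
      Subset.∣ S ∣ + Subset.∣ S ∣           ≤⟨ +-monoʳ-≤ Subset.∣ S ∣ ≤rest ⟩
      Subset.∣ S ∣ + (n ∸ 1 ∸ Subset.∣ S ∣) ≡⟨ m+[n∸m]≡n (≤-trans ≤rest (m∸n≤m _ Subset.∣ S ∣)) ⟩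
      n ∸ 1                                 ∎
      where
      open ≤-Reasoning
      ≤rest : Subset.∣ S ∣ ≤ n ∸ 1 ∸ Subset.∣ S ∣
      ≤rest = ≤-trans (minimal (rest-side side))
                      (≤-reflexive (trans (∣subset∣ (outside? w S)) (∣rest∣ (w∉S side))))

  open MinimalSide

  minimalSide : ∀ {w} → ∃ (Side G w) → ∃ (MinimalSide w)
  minimalSide {w} (S , s) = shrink S s (<-wellFounded _)
    where
    shrink : ∀ S → Side G w S → Acc _<_ Subset.∣ S ∣ → ∃ (MinimalSide w)
    shrink S s (acc rs) with anySubset? (λ S′ → side? w S′ ×-dec (Subset.∣ S′ ∣ <? Subset.∣ S ∣))
    ... | yes (S′ , s′ , <S) = shrink S′ s′ (rs <S)
    ... | no  none           = S , record { side = s ; minimal = λ s′ → ≮⇒≥ λ <S → none (_ , s′ , <S) }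

  -- How sides meet in a connected graph.

  module _ (conn : Connected G) where

    closed-everywhere : ∀ {P : Fin n → Set} → (∀ {x y} → P x → x ~ y → P y) → ∀ {x} → P x → ∀ y → P y
    closed-everywhere {P} P-closed {x} px y = along (proj₂ (conn x y)) px
      where
      along : ∀ {k u v} → Walk G k u v → P u → P v
      along stay       pu = pu
      along (step e p) pu = along p (P-closed pu e)

    -- The difference of `B` and `S` is closed under adjacency: `B` can be left only to `x`, which
    -- lies in `S`, and `S` can be entered only from `w`, which is not in `B`. Were it nonempty, it
    -- would contain `x`, which is not in `B`.
    side-⊆ : ∀ {w x S B} → Side G w S → Side G x B → x ∈ S → w ∉ B → B Subset.⊆ S
    side-⊆ {w} {x} {S} {B} s b x∈S w∉B {y} y∈B = decidable-stable (y ∈? S) λ y∉S →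
      w∉S b (proj₁ (closed-everywhere {P = λ y → y ∈ B × y ∉ S} extend (y∈B , y∉S) x))
      where
      extend : ∀ {y z} → y ∈ B × y ∉ S → y ~ z → z ∈ B × z ∉ S
      extend {y} {z} (y∈B , y∉S) y~z = closed b y z y∈B y~z (λ { refl → z∉S x∈S }) , z∉S
        where
        z∉S : z ∉ S
        z∉S z∈S = y∉S (closed s z y z∈S (~-sym y~z) λ { refl → w∉B y∈B })

    -- A cut vertex `x` in `S` has a side that avoids `w`. By `side-⊆` it lies within `S`, and it
    -- misses `x`, so the search continues in a smaller side.
    noncut-in-side : ∀ {C : Subset n} → (∀ {v} → v ∈ C → IsCutVertex G v) →
                     ∀ {w S} → Side G w S → ∃ λ z → z ∈ S × z ∉ C
    noncut-in-side {C} C-cut s = descend s (<-wellFounded _)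
      where
      descend : ∀ {w S} → Side G w S → Acc _<_ Subset.∣ S ∣ → ∃ λ z → z ∈ S × z ∉ C
      descend {w} {S} s (acc rs) with inner s
      ... | x , x∈S with x ∈? C
      ...   | no  x∉C = x , x∈S , x∉C
      ...   | yes x∈C = let B , b , w∉B = avoiding (cut⇒side (C-cut x∈C))
                            B⊆S = side-⊆ s b x∈S w∉B
                            z , z∈B , z∉C = descend b (rs (p⊂q⇒∣p∣<∣q∣ (B⊆S , x , x∈S , w∉S b)))
                        in z , B⊆S z∈B , z∉C
        where
        -- A side of `x` and its rest are disjoint, so one of them avoids `w`.
        avoiding : ∃ (Side G x) → ∃ λ B → Side G x B × w ∉ B
        avoiding (B , b) with w ∈? B
        ... | yes w∈B = _ , rest-side b , λ w∈ → proj₁ (∈-subset⁻ (outside? x B) w∈) w∈B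
        ... | no  w∉B = B , b , w∉B

    -- Since `w′` is not in `S`, the intersection of `S` and `S′` is again a side of `w`. Minimality
    -- gives that `S` is contained in `S′`, and the sizes force equality. If `w` and `w′` differed,
    -- the common set could be left neither to `w` nor to `w′`, and so would be the whole graph.
    nested⇒≡ : ∀ {w w′ S S′ z} → MinimalSide w S → Side G w′ S′ → z ∈ S → z ∈ S′ → w′ ∉ S →
               Subset.∣ S′ ∣ ≤ Subset.∣ S ∣ → w ≡ w′
    nested⇒≡ {w} {w′} {S} {S′} {z} m s′ z∈S z∈S′ w′∉S S′≤S = decidable-stable (w ≟ᶠ w′) λ w≢w′ →
      w∉S s (closed-everywhere {P = _∈ S} (extend w≢w′) z∈S w)
      where
      s = side m
      S∩S′ = S Subset.∩ S′
      common : Side G w S∩S′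
      common = record
        { w∉S    = w∉S s ∘ p∩q⊆p S S′
        ; closed = λ x y x∈ x~y w≢y → let x∈S , x∈S′ = x∈p∩q⁻ S S′ x∈
                                          y∈S = closed s x y x∈S x~y w≢y
                                      in x∈p∩q⁺ (y∈S , closed s′ x y x∈S′ x~y λ { refl → w′∉S y∈S })
        ; inner  = z , x∈p∩q⁺ (z∈S , z∈S′)
        ; outer  = let y , y∉S , w≢y = outer s in y , y∉S ∘ p∩q⊆p S S′ , w≢y
        }
      S⊆S′ : S Subset.⊆ S′
      S⊆S′ {x} x∈S = decidable-stable (x ∈? S′) λ x∉S′ → <⇒≱
        (p⊂q⇒∣p∣<∣q∣ {p = S∩S′} {q = S} (p∩q⊆p S S′ , x , x∈S , x∉S′ ∘ proj₂ ∘ x∈p∩q⁻ S S′)) (minimal m common)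
      S′⊆S : S′ Subset.⊆ S
      S′⊆S {x} x∈S′ = decidable-stable (x ∈? S) λ x∉S → <⇒≱
        (p⊂q⇒∣p∣<∣q∣ {p = S} {q = S′} (S⊆S′ , x , x∈S′ , x∉S)) S′≤S
      extend : w ≢ w′ → ∀ {x y} → x ∈ S → x ~ y → y ∈ S
      extend w≢w′ {x} {y} x∈S x~y with w ≟ᶠ y
      ... | no  w≢y  = closed s x y x∈S x~y w≢y
      -- An edge from `S` to `w` stays within `S′`, because only `w′` can be reached by leaving
      -- `S′`.
      ... | yes refl = S′⊆S (closed s′ x y (S⊆S′ x∈S) x~y (w≢w′ ∘ sym))

    -- The vertices in neither set are closed under adjacency: `S` can be entered only from `w`,
    -- which lies in `S′`, and symmetrically. If there were any, `w` would be among them.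
    mutual-sides-cover : ∀ {w w′ S S′} → Side G w S → Side G w′ S′ → w′ ∈ S → w ∈ S′ →
                         n ≤ Subset.∣ S ∣ + Subset.∣ S′ ∣
    mutual-sides-cover {w} {w′} {S} {S′} s s′ w′∈S w∈S′ = begin
      n
        ≡⟨ trans (∑-const n 1) (*-identityʳ n) ⟨
      ∑[ x < n ] 1
        ≤⟨ ∑-mono-≤ covered ⟩
      ∑[ x < n ] (ind (x ∈? S) + ind (x ∈? S′))
        ≡⟨ ∑-distrib-+ (λ x → ind (x ∈? S)) (λ x → ind (x ∈? S′)) ⟩
      ∑[ x < n ] ind (x ∈? S) + ∑[ x < n ] ind (x ∈? S′)
        ≡⟨ cong₂ _+_ (∣p∣≡∑ind S) (∣p∣≡∑ind S′) ⟨
      Subset.∣ S ∣ + Subset.∣ S′ ∣ ∎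
      where
      open ≤-Reasoning
      extend : ∀ {x y} → x ∉ S × x ∉ S′ → x ~ y → y ∉ S × y ∉ S′
      extend {x} {y} (x∉S , x∉S′) x~y =
        (λ y∈S  → x∉S  (closed s  y x y∈S  (~-sym x~y) λ { refl → x∉S′ w∈S′ })) ,
        (λ y∈S′ → x∉S′ (closed s′ y x y∈S′ (~-sym x~y) λ { refl → x∉S w′∈S }))
      covered : ∀ x → 1 ≤ ind (x ∈? S) + ind (x ∈? S′)
      covered x with x ∈? S | x ∈? S′
      ... | yes _  | _       = s≤s z≤n
      ... | no  _  | yes _   = ≤-refl
      ... | no x∉S | no x∉S′ =
        contradiction w∈S′ (proj₂ (closed-everywhere {P = λ x → x ∉ S × x ∉ S′} extend (x∉S , x∉S′) w))

    -- If one of the two vertices is outside the other's side, `nested⇒≡` applies. Otherwise the two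
    -- sides cover the graph, although together they have at most `n ∸ 1` vertices by `twice≤`.
    minimalSide-injective : ∀ {w w′ S S′ z} → 1 ≤ n → MinimalSide w S → MinimalSide w′ S′ →
                            z ∈ S → z ∈ S′ → Subset.∣ S ∣ ≡ Subset.∣ S′ ∣ → w ≡ w′
    minimalSide-injective {w} {w′} {S} {S′} 1≤n m m′ z∈S z∈S′ eq with w′ ∈? S | w ∈? S′
    ... | no  w′∉S | _       = nested⇒≡ m (side m′) z∈S z∈S′ w′∉S (≤-reflexive (sym eq))
    ... | yes _    | no w∉S′ = sym (nested⇒≡ m′ (side m) z∈S′ z∈S w∉S′ (≤-reflexive eq))
    ... | yes w′∈S | yes w∈S′ = contradiction (mutual-sides-cover (side m) (side m′) w′∈S w∈S′) (<⇒≱ (begin-strict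
      Subset.∣ S ∣ + Subset.∣ S′ ∣            ≡⟨ cong (Subset.∣ S ∣ +_) eq ⟨
      Subset.∣ S ∣ + Subset.∣ S ∣             ≤⟨ twice≤ m ⟩
      n ∸ 1                                   <⟨ ∸-monoʳ-< (s≤s z≤n) 1≤n ⟩
      n                                       ∎))
      where open ≤-Reasoning

  -- The lower bound for distances and for the Wiener index.

  module _ (A : Fin n → Subset n) (w∉A : ∀ w → w ∉ A w)
           (A-closed : ∀ w x y → x ∈ A w → x ~ y → w ≢ y → y ∈ A w) where
    open Sides A w∉A

    -- After a step from `u` to `x`, every `w` other than `x` that separated `u` from `v` separates
    -- `x` from `v`. So each edge removes at most one separator.
    crossings<length : ∀ {k u v} → Walk G k u v → u ≢ v → crossings u v < k
    crossings<length stay u≢u = contradiction refl u≢u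
    crossings<length {u = u} {v} (step {v = x} {k = k} u~x p) _ with x ≟ᶠ v
    -- Adjacent vertices have no separator, so the last edge provides the strictness.
    ... | yes refl = s≤s (≤-trans (≤-reflexive (trans (sum-cong-≗ none) (trans (∑-const n 0) (*-zeroʳ n)))) z≤n)
      where
      none : ∀ w → crossing w u v ≡ 0
      none w = cong₂ _+_ (ind-false (separates? w u v) λ (u∈ , v∉ , w≢v) → v∉ (A-closed w u v u∈ u~x w≢v))
                         (ind-false (separates? w v u) λ (v∈ , u∉ , w≢u) → u∉ (A-closed w v u v∈ (~-sym u~x) w≢u))
    ... | no x≢v = s≤s (≤-trans (∑-mono-≤-except x
        (ind-+-exclusive (separates? x u v) (separates? x v u) λ (u∈ , _) (_ , u∉ , _) → u∉ u∈)
        λ w w≢x → +-mono-≤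
          (ind-mono (separates? w u v) (separates? w x v) λ (u∈ , o) → A-closed w u x u∈ u~x w≢x , o)
          (ind-mono (separates? w v u) (separates? w v x) λ (v∈ , u∉ , w≢u) →
            v∈ , (λ x∈ → u∉ (A-closed w x u x∈ (~-sym u~x) w≢u)) , w≢x))
        (crossings<length p x≢v))

    wienerIndex-≥ : (conn : Connected G) →
      ∑-< n (λ _ _ → 1) + ∑[ w < n ] (Subset.∣ A w ∣ * (n ∸ 1 ∸ Subset.∣ A w ∣)) ≤ wienerIndex G conn
    wienerIndex-≥ conn = ≤-trans (≤-reflexive (sym ∑-crossings))
      (∑-<-mono λ {u} {v} u≢v → crossings<length (proj₁ (proj₂ (distance G conn u v))) u≢v)

-- Minimising the sum of `cutPairs`.

≤∑ : ∀ {n} (f : Vector ℕ n) i → f i ≤ sum f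
≤∑ f zero    = m≤m+n (f zero) _
≤∑ f (suc i) = ≤-trans (≤∑ (f ∘ suc) i) (m≤n+m _ (f zero))

-- Each `w` with `x w < q` is charged to the pair of `r w` and `x w`. No pair is charged twice, and
-- only vertices outside `C` occur in first place.
∑-injective-≤ : ∀ {n} (C : Subset n) (r : Fin n → Fin n) (x : Fin n → ℕ) (g : ℕ → ℕ) q →
  (∀ w → r w ∉ C) → (∀ {w w′} → r w ≡ r w′ → x w ≡ x w′ → w ≡ w′) →
  (∀ w → q ≤ x w → g (x w) ≡ 0) →
  ∑[ w < n ] g (x w) ≤ (n ∸ Subset.∣ C ∣) * ∑[ a < q ] g (toℕ a)
∑-injective-≤ {n} C r x g q r∉C injective vanish = begin
  ∑[ w < n ] g (x w)
    ≤⟨ ∑-mono-≤ row ⟩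
  ∑[ w < n ] h w
    ≡⟨ sum-cong-≗ (λ w → ∑-select (r w) (λ _ → h w)) ⟨
  ∑[ w < n ] ∑[ z < n ] (ind (r w ≟ᶠ z) * h w)
    ≡⟨ ∑-comm (λ w z → ind (r w ≟ᶠ z) * h w) ⟩
  ∑[ z < n ] ∑[ w < n ] (ind (r w ≟ᶠ z) * h w)
    ≤⟨ ∑-mono-≤ fibre ⟩
  ∑[ z < n ] ∑[ a < q ] (ind (z ∈? Subset.∁ C) * g (toℕ a))
    ≡⟨ ∑-product (λ z → ind (z ∈? Subset.∁ C)) (g ∘ toℕ {q}) ⟩
  ∑[ z < n ] ind (z ∈? Subset.∁ C) * ∑[ a < q ] g (toℕ a)
    ≡⟨ cong (_* ∑[ a < q ] g (toℕ a)) (trans (sym (∣p∣≡∑ind (Subset.∁ C))) (∣∁p∣≡n∸∣p∣ C)) ⟩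
  (n ∸ Subset.∣ C ∣) * ∑[ a < q ] g (toℕ a) ∎
  where
  open ≤-Reasoning
  -- This is `g (x w)` if `x w < q` and 0 otherwise, written as a sum so that the order of summation
  -- can be exchanged.
  h : Fin n → ℕ
  h w = ∑[ a < q ] (ind (toℕ a ≟ x w) * g (toℕ a))
  row : ∀ w → g (x w) ≤ h w
  row w with q ≤? x w
  ... | yes q≤x = ≤-trans (≤-reflexive (vanish w q≤x)) z≤n
  ... | no  q≰x = begin
    g (x w)                         ≡⟨ cong g a≡ ⟨
    g (toℕ a)                       ≡⟨ *-identityˡ _ ⟨
    1 * g (toℕ a)                   ≡⟨ cong (_* g (toℕ a)) (ind-true (toℕ a ≟ x w) a≡) ⟨
    ind (toℕ a ≟ x w) * g (toℕ a)   ≤⟨ ≤∑ (λ a → ind (toℕ a ≟ x w) * g (toℕ a)) a ⟩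
    h w ∎
    where
    a = fromℕ< (≰⇒> q≰x)
    a≡ : toℕ a ≡ x w
    a≡ = toℕ-fromℕ< (≰⇒> q≰x)
  fibre-ind : ∀ z a → ∑[ w < n ] (ind (r w ≟ᶠ z) * ind (toℕ {q} a ≟ x w)) ≤ ind (z ∈? Subset.∁ C)
  fibre-ind z a = begin
    ∑[ w < n ] (ind (r w ≟ᶠ z) * ind (toℕ a ≟ x w)) ≡⟨ sum-cong-≗ (λ w → ind-× (r w ≟ᶠ z) (toℕ a ≟ x w)) ⟨
    ∑[ w < n ] ind (both? w)                        ≤⟨ bound ⟩
    ind (z ∈? Subset.∁ C) ∎
    where
    both? : ∀ w → Dec (r w ≡ z × toℕ a ≡ x w)
    both? w = (r w ≟ᶠ z) ×-dec (toℕ a ≟ x w)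
    bound : ∑[ w < n ] ind (both? w) ≤ ind (z ∈? Subset.∁ C)
    bound with z ∈? Subset.∁ C
    ... | yes _   = ∑-ind-unique both? λ (p , p′) (q , q′) → injective (trans p (sym q)) (trans (sym p′) q′)
    ... | no  z∉∁ = ≤-reflexive (∑-ind-empty both? λ { w (refl , _) → z∉∁ (x∉p⇒x∈∁p (r∉C w)) })
  fibre : ∀ z → ∑[ w < n ] (ind (r w ≟ᶠ z) * h w) ≤ ∑[ a < q ] (ind (z ∈? Subset.∁ C) * g (toℕ a))
  fibre z = begin
    ∑[ w < n ] (ind (r w ≟ᶠ z) * h w)
      ≡⟨ sum-cong-≗ (λ w → *-distribˡ-sum {q} (ind (r w ≟ᶠ z)) _) ⟩
    ∑[ w < n ] ∑[ a < q ] (ind (r w ≟ᶠ z) * (ind (toℕ a ≟ x w) * g (toℕ a)))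
      ≡⟨ ∑-comm {n} {q} _ ⟩
    ∑[ a < q ] ∑[ w < n ] (ind (r w ≟ᶠ z) * (ind (toℕ a ≟ x w) * g (toℕ a)))
      ≡⟨ sum-cong-≗ {q} (λ a → sum-cong-≗ {n} λ w → sym (*-assoc (ind (r w ≟ᶠ z)) _ _)) ⟩
    ∑[ a < q ] ∑[ w < n ] (ind (r w ≟ᶠ z) * ind (toℕ a ≟ x w) * g (toℕ a))
      ≡⟨ sum-cong-≗ {q} (λ a → *-distribʳ-sum {n} (g (toℕ a)) _) ⟨
    ∑[ a < q ] (∑[ w < n ] (ind (r w ≟ᶠ z) * ind (toℕ a ≟ x w)) * g (toℕ a))
      ≤⟨ ∑-mono-≤ {q} (λ a → *-monoˡ-≤ (g (toℕ a)) (fibre-ind z a)) ⟩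
    ∑[ a < q ] (ind (z ∈? Subset.∁ C) * g (toℕ a)) ∎

-- The number of pairs separated by a vertex that cuts off x of the n vertices.
cutPairs : ℕ → ℕ → ℕ
cutPairs n x = x * (n ∸ 1 ∸ x)

-- With `y` equal to `x + d` and `n ∸ 1` equal to `y + y + e`, the difference of the two values is
-- `d * d + d * e`.
cutPairs-mono : ∀ n {x y} → x ≤ y → y + y ≤ n ∸ 1 → cutPairs n x ≤ cutPairs n y
cutPairs-mono n {x} x≤y 2y≤N with m≤n⇒∃[o]m+o≡n x≤y | m≤n⇒∃[o]m+o≡n 2y≤N
... | d , refl | e , eq = begin
  x * (n ∸ 1 ∸ x)                          ≡⟨ cong (λ N → x * (N ∸ x)) (trans (sym eq) split₁) ⟩
  x * (x + (x + d + d + e) ∸ x)            ≡⟨ cong (x *_) (m+n∸m≡n x _) ⟩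
  x * (x + d + d + e)                      ≤⟨ m≤m+n _ (d * d + d * e) ⟩
  x * (x + d + d + e) + (d * d + d * e)    ≡⟨ expand ⟩
  (x + d) * (x + d + e)                    ≡⟨ cong ((x + d) *_) (m+n∸m≡n (x + d) _) ⟨
  (x + d) * (x + d + (x + d + e) ∸ (x + d)) ≡⟨ cong (λ N → (x + d) * (N ∸ (x + d))) (trans (sym eq) (+-assoc (x + d) _ e)) ⟨
  (x + d) * (n ∸ 1 ∸ (x + d)) ∎
  where
  open ≤-Reasoning
  open +-*-Solver
  split₁ : x + d + (x + d) + e ≡ x + (x + d + d + e)
  split₁ = solve 3 (λ x d e → x :+ d :+ (x :+ d) :+ e := x :+ (x :+ d :+ d :+ e)) refl x d e
  expand : x * (x + d + d + e) + (d * d + d * e) ≡ (x + d) * (x + d + e)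
  expand = solve 3 (λ x d e → x :* (x :+ d :+ d :+ e) :+ (d :* d :+ d :* e) := (x :+ d) :* (x :+ d :+ e)) refl x d e

-- Both sums are compared with `n * f q`, after `m` copies of the total deficit below `q` are added
-- to each.
∑-cutPairs-≤ : ∀ {n m} (C : Subset n) (l : Vector ℕ m) q (r : Fin n → Fin n) (x : Fin n → ℕ) →
  sum l ≡ n → n ∸ Subset.∣ C ∣ ≡ m → (∀ i → q ≤ l i × l i ≤ suc q) → q + q ≤ n ∸ 1 →
  (∀ w → r w ∉ C) → (∀ {w w′} → r w ≡ r w′ → x w ≡ x w′ → w ≡ w′) →
  (∀ w → x w + x w ≤ n ∸ 1) →
  ∑[ i < m ] ∑[ a < l i ] cutPairs n (toℕ a) ≤ ∑[ w < n ] cutPairs n (x w)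
∑-cutPairs-≤ {n} {m} C l q r x Σl≡n n∸∣C∣≡m balanced 2q≤N r∉C injective 2x≤N =
  +-cancelʳ-≤ (m * ∑[ a < q ] g (toℕ a)) _ _ (begin
    ∑[ i < m ] ∑[ a < l i ] f (toℕ a) + m * ∑[ a < q ] g (toℕ a)
      ≡⟨ cong (∑[ i < m ] ∑[ a < l i ] f (toℕ a) +_) (∑-const m _) ⟨
    ∑[ i < m ] ∑[ a < l i ] f (toℕ a) + ∑[ i < m ] ∑[ a < q ] g (toℕ a)
      ≡⟨ ∑-distrib-+ (λ i → ∑[ a < l i ] f (toℕ a)) (λ _ → ∑[ a < q ] g (toℕ a)) ⟨
    ∑[ i < m ] (∑[ a < l i ] f (toℕ a) + ∑[ a < q ] g (toℕ a))
      ≤⟨ ∑-mono-≤ branch ⟩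
    ∑[ i < m ] (l i * f q)
      ≡⟨ *-distribʳ-sum (f q) l ⟨
    sum l * f q
      ≡⟨ trans (cong (_* f q) Σl≡n) (sym (∑-const n (f q))) ⟩
    ∑[ w < n ] f q
      -- Only an inequality: the deficit is truncated to 0 where `f (x w)` exceeds `f q`.
      ≤⟨ ∑-mono-≤ (λ w → m≤n+m∸n (f q) (f (x w))) ⟩
    ∑[ w < n ] (f (x w) + g (x w))
      ≡⟨ ∑-distrib-+ (f ∘ x) (g ∘ x) ⟩
    ∑[ w < n ] f (x w) + ∑[ w < n ] g (x w)
      ≤⟨ +-monoʳ-≤ _ (∑-injective-≤ C r x g q r∉C injective λ w q≤x →
           m≤n⇒m∸n≡0 (cutPairs-mono n q≤x (2x≤N w))) ⟩
    ∑[ w < n ] f (x w) + (n ∸ Subset.∣ C ∣) * ∑[ a < q ] g (toℕ a)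
      ≡⟨ cong (λ k → ∑[ w < n ] f (x w) + k * ∑[ a < q ] g (toℕ a)) n∸∣C∣≡m ⟩
    ∑[ w < n ] f (x w) + m * ∑[ a < q ] g (toℕ a) ∎)
  where
  open ≤-Reasoning
  -- g is the deficit of f against f q: f + g ≥ f q everywhere, with equality up to q.
  f g : ℕ → ℕ
  f = cutPairs n
  g a = f q ∸ f a
  branch : ∀ i → ∑[ a < l i ] f (toℕ a) + ∑[ a < q ] g (toℕ a) ≤ l i * f q
  branch i = begin
    ∑[ a < l i ] f (toℕ a) + ∑[ a < q ] g (toℕ a)
      -- Nothing is lost here: if `l i` is `suc q`, the extra term is `g q`, which is 0.
      ≤⟨ +-monoʳ-≤ _ (∑-extend g (proj₁ (balanced i))) ⟩
    ∑[ a < l i ] f (toℕ a) + ∑[ a < l i ] g (toℕ a)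
      ≡⟨ ∑-distrib-+ (f ∘ toℕ {l i}) (g ∘ toℕ) ⟨
    ∑[ a < l i ] (f (toℕ a) + g (toℕ a))
      -- From `a < l i` and `l i ≤ suc q` follows `a ≤ q`, so the subtraction in `g` is exact.
      ≡⟨ sum-cong-≗ {l i} (λ a → m+[n∸m]≡n (cutPairs-mono n (s≤s⁻¹ (≤-trans (toℕ<n a) (proj₂ (balanced i)))) 2q≤N)) ⟩
    ∑[ a < l i ] f q
      ≡⟨ ∑-const (l i) (f q) ⟩
    l i * f q ∎

-- Labelling the vertices of an arbitrary graph.

-- For w ∈ C this is a smallest side of w with a non-cut vertex rep in it;
-- w ∉ C counts as having an empty side, so that sums may run over all vertices.
record Label {n} (G : Graph (Fin n)) (C : Subset n) (w : Fin n) : Set where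
  field
    A        : Subset n
    rep      : Fin n
    rep∉C    : rep ∉ C
    A-or-∅   : (MinimalSide G w A × rep ∈ A) ⊎ (A ≡ Subset.⊥ × rep ≡ w)

  w∉A : w ∉ A
  w∉A with A-or-∅
  ... | inj₁ (m , _)      = Side.w∉S (MinimalSide.side m)
  ... | inj₂ (A≡⊥ , _)    = λ w∈A → ∉⊥ (subst (w ∈_) A≡⊥ w∈A)

  closed : ∀ x y → x ∈ A → Graph._~_ G x y → w ≢ y → y ∈ A
  closed x y x∈A with A-or-∅
  ... | inj₁ (m , _)      = Side.closed (MinimalSide.side m) x y x∈A
  ... | inj₂ (A≡⊥ , _)    = contradiction (subst (x ∈_) A≡⊥ x∈A) ∉⊥

  size : ℕ
  size = Subset.∣ A ∣

  twice-size≤ : size + size ≤ n ∸ 1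
  twice-size≤ with A-or-∅
  ... | inj₁ (m , _)      = MinimalSide.twice≤ m
  ... | inj₂ (A≡⊥ , _)    = ≤-trans (≤-reflexive (cong (λ S → Subset.∣ S ∣ + Subset.∣ S ∣) A≡⊥))
                                    (≤-trans (≤-reflexive (cong₂ _+_ (∣⊥∣≡0 n) (∣⊥∣≡0 n))) z≤n)

module _ {n} (G : Graph (Fin n)) (conn : Connected G) (C : Subset n) where
  open Label

  label : (∀ {v} → v ∈ C → IsCutVertex G v) → ∀ w → Label G C w
  label C-cut w with w ∈? C
  ... | no  w∉C = record { A = Subset.⊥ ; rep = w ; rep∉C = w∉C ; A-or-∅ = inj₂ (refl , refl) }
  ... | yes w∈C =
    let S , m = minimalSide G (cut⇒side G (C-cut w∈C))
        z , z∈S , z∉C = noncut-in-side G conn C-cut (MinimalSide.side m)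
    in record { A = S ; rep = z ; rep∉C = z∉C ; A-or-∅ = inj₁ (m , z∈S) }

  minimalSide-nonempty : ∀ {w S} → MinimalSide G w S → Subset.∣ S ∣ ≢ Subset.∣ Subset.⊥ {n} ∣
  minimalSide-nonempty m S≡0 with Side.inner (MinimalSide.side m)
  ... | x , x∈S = <⇒≢ (p⊂q⇒∣p∣<∣q∣ ((λ y∈⊥ → contradiction y∈⊥ ∉⊥) , x , x∈S , ∉⊥)) (sym S≡0)

  -- A side is nonempty, so equal sizes exclude one empty and one nonempty set; two empty sets leave
  -- `rep` equal to the vertex itself.
  label-injective : ∀ {w w′} (L : Label G C w) (L′ : Label G C w′) →
                    rep L ≡ rep L′ → size L ≡ size L′ → w ≡ w′
  label-injective {w} L L′ rep≡ size≡ with A-or-∅ L | A-or-∅ L′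
  ... | inj₁ (m , r)      | inj₁ (m′ , r′)     =
    minimalSide-injective G conn (≤-trans (s≤s z≤n) (toℕ<n w)) m m′ r (subst (_∈ A L′) (sym rep≡) r′) size≡
  ... | inj₁ (m , _)      | inj₂ (A≡⊥ , _)     = contradiction (trans size≡ (cong Subset.∣_∣ A≡⊥)) (minimalSide-nonempty m)
  ... | inj₂ (A≡⊥ , _)    | inj₁ (m , _)       = contradiction (trans (sym size≡) (cong Subset.∣_∣ A≡⊥)) (minimalSide-nonempty m)
  ... | inj₂ (_ , r≡w)    | inj₂ (_ , r≡w′)    = trans (sym r≡w) (trans rep≡ r≡w′)

balanced-bound : ∀ {n m} (l : Vector ℕ m) q (G : Graph (Fin n)) (conn : Connected G) (C : Subset n) →
  sum l ≡ n → n ∸ Subset.∣ C ∣ ≡ m → (∀ i → q ≤ l i × l i ≤ suc q) → q + q ≤ n ∸ 1 →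
  (∀ {v} → v ∈ C → IsCutVertex G v) →
  ∑-< n (λ _ _ → 1) + ∑[ i < m ] ∑[ a < l i ] cutPairs n (toℕ a) ≤ wienerIndex G conn
balanced-bound {n} {m} l q G conn C Σl≡n n∸∣C∣≡m balanced 2q≤N C-cut =
  ≤-trans (+-monoʳ-≤ (∑-< n λ _ _ → 1)
            (∑-cutPairs-≤ C l q (λ w → rep (L w)) (λ w → size (L w)) Σl≡n n∸∣C∣≡m balanced 2q≤N
              (λ w → rep∉C (L w)) (λ {w} {w′} → label-injective G conn C (L w) (L w′)) (λ w → twice-size≤ (L w))))
          (wienerIndex-≥ G (λ w → A (L w)) (λ w → w∉A (L w)) (λ w → closed (L w)) conn)
  where
  open Label
  L = label G conn C C-cut

-- Counting along paths, and reversing walks.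

count-above : ∀ L h → ∑[ a < L ] ind (h <? toℕ a) ≡ L ∸ suc h
count-above zero    h       = refl
count-above (suc L) zero    = trans (∑-const L 1) (*-identityʳ L)
count-above (suc L) (suc h) = count-above L h

count-below : ∀ {L k} → k ≤ L → ∑[ a < L ] ind (toℕ a <? k) ≡ k
count-below {L} z≤n       = ∑-ind-empty {L} (λ a → toℕ a <? 0) λ _ ()
count-below     (s≤s k≤L) = cong suc (count-below k≤L)

∑-split : ∀ a {b} (f : Vector ℕ (a + b)) →
          sum f ≡ ∑[ i < a ] f (i ↑ˡ b) + ∑[ j < b ] f (a ↑ʳ j)
∑-split zero    f = refl
∑-split (suc a) f = trans (cong (f zero +_) (∑-split a (f ∘ suc))) (sym (+-assoc (f zero) _ _))

∑-locate : ∀ {m} (l : Vector ℕ m) (F : PathVertex l → ℕ) →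
           ∑[ u < sum l ] F (Inverse.to (locate l) u) ≡ ∑[ i < m ] ∑[ a < l i ] F (i , a)
∑-locate {zero}  l F = refl
∑-locate {suc m} l F = trans (∑-split (l zero) _) (cong₂ _+_
  (sum-cong-≗ {l zero} λ a → first a)
  (trans (sum-cong-≗ {sum l′} λ u → later u) (∑-locate l′ λ (i , a) → F (suc i , a))))
  where
  l′ : Vector ℕ m
  l′ = l ∘ suc
  first : ∀ a → F (Inverse.to (locate l) (a ↑ˡ sum l′)) ≡ F (zero , a)
  first a rewrite splitAt-↑ˡ (l zero) a (sum l′) = refl
  later : ∀ u → F (Inverse.to (locate l) (l zero ↑ʳ u)) ≡
                F (let (i , a) = Inverse.to (locate l′) u in suc i , a)
  later u rewrite splitAt-↑ʳ (l zero) (sum l′) u = refl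

walk-snoc : ∀ {V} {G : Graph V} {k u v w} → Walk G k u v → Graph._~_ G v w → Walk G (suc k) u w
walk-snoc stay       e = step e stay
walk-snoc (step f p) e = step f (walk-snoc p e)

walk-reverse : ∀ {V} {G : Graph V} {k u v} → Walk G k u v → Walk G k v u
walk-reverse stay = stay
walk-reverse {G = G} (step e p) = walk-snoc (walk-reverse p) (Graph.~-sym G e)

module _ {m} {l : Vector ℕ m} where

  pathVertex-≡ : ∀ {p q : PathVertex l} → proj₁ p ≡ proj₁ q → toℕ (proj₂ p) ≡ toℕ (proj₂ q) → p ≡ q
  pathVertex-≡ {i , _} refl a≡b = cong (i ,_) (toℕ-injective a≡b)

  pathAdj-path : ∀ {p q : PathVertex l} → proj₁ p ≡ proj₁ q →
                 ∣ toℕ (proj₂ p) - toℕ (proj₂ q) ∣ ≡ 1 → PathAdj l p q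
  pathAdj-path refl e = path e

  pathAdj-cases : ∀ {p q : PathVertex l} → PathAdj l p q →
                  (toℕ (proj₂ p) ≡ 0) ⊎ (proj₁ p ≡ proj₁ q × ∣ toℕ (proj₂ p) - toℕ (proj₂ q) ∣ ≡ 1)
  pathAdj-cases (clique _ a≡0 _) = inj₁ a≡0
  pathAdj-cases (path e)         = inj₂ (refl , e)

-- The clique with paths attached.

module CliqueWithPaths {m} (n : ℕ) (l : Vector ℕ m) (Σl≡n : sum l ≡ n)
                       (2≤m : 2 ≤ m) (l-pos : ∀ i → 1 ≤ l i) where

  Kₗ : Graph (Fin n)
  Kₗ = K n l Σl≡n

  open Graph Kₗ

  position : Fin n ↔ PathVertex l
  position = ↔-trans (cast-id (sym Σl≡n)) (locate l)

  branch : Fin n → Fin m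
  branch u = proj₁ (Inverse.to position u)

  height : Fin n → ℕ
  height u = toℕ (proj₂ (Inverse.to position u))

  height< : ∀ u → height u < l (branch u)
  height< u = toℕ<n (proj₂ (Inverse.to position u))

  vertex-≡ : ∀ {u v} → branch u ≡ branch v → height u ≡ height v → u ≡ v
  vertex-≡ b h = Injection.injective (↔⇒↣ position) (pathVertex-≡ b h)

  vertexAt : ∀ i {h} → h < l i → ∃ λ u → branch u ≡ i × height u ≡ h
  vertexAt i h<l = Inverse.from position p ,
    cong proj₁ eq , trans (cong (λ p → toℕ (proj₂ p)) eq) (toℕ-fromℕ< h<l)
    where
    p : PathVertex l
    p = i , fromℕ< h<l
    eq = Inverse.strictlyInverseˡ position p

  parent : ∀ u {h} → height u ≡ suc h → ∃ λ u′ → branch u′ ≡ branch u × height u′ ≡ h × u ~ u′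
  parent u {h} hu with vertexAt (branch u) {h} (<-trans (≤-reflexive (sym hu)) (height< u))
  ... | u′ , b , h′ = u′ , b , h′ , pathAdj-path (sym b)
        (trans (cong₂ ∣_-_∣ hu h′) (trans (∣-∣-comm (suc h) h)
          (trans (cong (λ k → ∣ h - k ∣) (+-comm 1 h)) (∣m-m+n∣≡n h 1))))

  ∑-vertices : (F : (i : Fin m) → ℕ → ℕ) →
               ∑[ u < n ] F (branch u) (height u) ≡ ∑[ i < m ] ∑[ a < l i ] F i (toℕ a)
  ∑-vertices F = go Σl≡n
    where
    -- The number of vertices is made a variable, so that matching on `refl` turns the cast into the
    -- identity.
    go : ∀ {n} (eq : sum l ≡ n) →
         ∑[ u < n ] (let (i , a) = Inverse.to (↔-trans (cast-id (sym eq)) (locate l)) u in F i (toℕ a)) ≡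
         ∑[ i < m ] ∑[ a < l i ] F i (toℕ a)
    go refl = trans (sum-cong-≗ {sum l} λ u → cong (λ v → let (i , a) = Inverse.to (locate l) v in F i (toℕ a)) (cast-is-id refl u))
                    (∑-locate l λ (i , a) → F i (toℕ a))

  Above : Fin n → Fin n → Set
  Above w u = branch w ≡ branch u × height w < height u

  above? : ∀ w → Decidable (Above w)
  above? w u = (branch w ≟ᶠ branch u) ×-dec (height w <? height u)

  A : Fin n → Subset n
  A w = subset (above? w)

  ∈A⁺ : ∀ {w u} → Above w u → u ∈ A w
  ∈A⁺ {w} = ∈-subset⁺ (above? w)

  ∈A⁻ : ∀ {w u} → u ∈ A w → Above w u
  ∈A⁻ {w} = ∈-subset⁻ (above? w)

  w∉A : ∀ w → w ∉ A w
  w∉A w w∈ = <-irrefl refl (proj₂ (∈A⁻ w∈))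

  -- A clique edge starts at height 0, where nothing lies above `w`. A path edge changes the height
  -- by one, so from above `w` it leads at lowest to the height of `w`, which means to `w` itself.
  A-closed : ∀ w x y → x ∈ A w → x ~ y → w ≢ y → y ∈ A w
  A-closed w x y x∈ x~y w≢y with ∈A⁻ x∈ | pathAdj-cases x~y
  ... | _ , w<x | inj₁ hx≡0 = contradiction (subst (height w <_) hx≡0 w<x) λ ()
  ... | b , w<x | inj₂ (b′ , e) = ∈A⁺ (trans b b′ , ≤∧≢⇒< w≤y λ h → w≢y (vertex-≡ (trans b b′) h))
    where
    x≤1+y : height x ≤ suc (height y)
    x≤1+y = ≤-trans (m≤n+∣m-n∣ (height x) (height y)) (≤-reflexive (trans (cong (height y +_) e) (+-comm _ 1)))
    w≤y : height w ≤ height y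
    w≤y = s≤s⁻¹ (≤-trans w<x x≤1+y)

  ∣A∣ : ∀ w → Subset.∣ A w ∣ ≡ l (branch w) ∸ suc (height w)
  ∣A∣ w = begin
    Subset.∣ A w ∣
      ≡⟨ ∣subset∣ (above? w) ⟩
    ∑[ u < n ] ind (above? w u)
      ≡⟨ sum-cong-≗ (λ u → ind-× (branch w ≟ᶠ branch u) (height w <? height u)) ⟩
    ∑[ u < n ] (ind (branch w ≟ᶠ branch u) * ind (height w <? height u))
      ≡⟨ ∑-vertices (λ i a → ind (branch w ≟ᶠ i) * ind (height w <? a)) ⟩
    ∑[ i < m ] ∑[ a < l i ] (ind (branch w ≟ᶠ i) * ind (height w <? toℕ a))
      ≡⟨ sum-cong-≗ (λ i → *-distribˡ-sum {l i} (ind (branch w ≟ᶠ i)) _) ⟨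
    ∑[ i < m ] (ind (branch w ≟ᶠ i) * ∑[ a < l i ] ind (height w <? toℕ a))
      ≡⟨ ∑-select (branch w) (λ i → ∑[ a < l i ] ind (height w <? toℕ a)) ⟩
    ∑[ a < l (branch w) ] ind (height w <? toℕ a)
      ≡⟨ count-above (l (branch w)) (height w) ⟩
    l (branch w) ∸ suc (height w) ∎
    where open ≡-Reasoning

  ∑-cutPairs-A : ∑[ w < n ] cutPairs n (Subset.∣ A w ∣) ≡ ∑[ i < m ] ∑[ a < l i ] cutPairs n (toℕ a)
  ∑-cutPairs-A = begin
    ∑[ w < n ] cutPairs n (Subset.∣ A w ∣)
      ≡⟨ sum-cong-≗ (λ w → cong (cutPairs n) (∣A∣ w)) ⟩
    ∑[ w < n ] cutPairs n (l (branch w) ∸ suc (height w))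
      ≡⟨ ∑-vertices (λ i a → cutPairs n (l i ∸ suc a)) ⟩
    ∑[ i < m ] ∑[ a < l i ] cutPairs n (l i ∸ suc (toℕ a))
      -- Up a path the sizes run from `l i ∸ 1` to 0; reversal lists them in increasing order.
      ≡⟨ sum-cong-≗ (λ i → ∑-reverse (l i) (cutPairs n)) ⟩
    ∑[ i < m ] ∑[ a < l i ] cutPairs n (toℕ a) ∎
    where open ≡-Reasoning

  nonTop? : Decidable (λ w → suc (height w) < l (branch w))
  nonTop? w = suc (height w) <? l (branch w)

  cutSet : Subset n
  cutSet = subset nonTop?

  ∣cutSet∣ : Subset.∣ cutSet ∣ ≡ n ∸ m
  ∣cutSet∣ = begin
    Subset.∣ cutSet ∣
      ≡⟨ ∣subset∣ nonTop? ⟩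
    ∑[ w < n ] ind (nonTop? w)
      ≡⟨ ∑-vertices (λ i a → ind (suc a <? l i)) ⟩
    ∑[ i < m ] ∑[ a < l i ] ind (suc (toℕ a) <? l i)
      ≡⟨ sum-cong-≗ (λ i → onBranch (l i)) ⟩
    ∑[ i < m ] (l i ∸ 1)
      ≡⟨ m+n∸n≡m _ m ⟨
    ∑[ i < m ] (l i ∸ 1) + m ∸ m
      ≡⟨ cong (_∸ m) total ⟩
    n ∸ m ∎
    where
    open ≡-Reasoning
    onBranch : ∀ L → ∑[ a < L ] ind (suc (toℕ a) <? L) ≡ L ∸ 1
    onBranch zero    = refl
    onBranch (suc L) = count-below (n≤1+n L)
    total : ∑[ i < m ] (l i ∸ 1) + m ≡ n
    total = begin
      ∑[ i < m ] (l i ∸ 1) + m            ≡⟨ cong (∑[ i < m ] (l i ∸ 1) +_) (trans (∑-const m 1) (*-identityʳ m)) ⟨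
      ∑[ i < m ] (l i ∸ 1) + ∑[ i < m ] 1 ≡⟨ ∑-distrib-+ (λ i → l i ∸ 1) (λ _ → 1) ⟨
      ∑[ i < m ] (l i ∸ 1 + 1)            ≡⟨ sum-cong-≗ (λ i → m∸n+n≡m (l-pos i)) ⟩
      sum l                               ≡⟨ Σl≡n ⟩
      n ∎

  -- The next vertex of the path lies in `A w`; a clique vertex on another path, which `2 ≤ m`
  -- provides, lies outside.
  nonTop⇒side : ∀ {w} → suc (height w) < l (branch w) → Side Kₗ w (A w)
  nonTop⇒side {w} <l = record
    { w∉S    = w∉A w
    ; closed = A-closed w
    ; inner  = let u , b , h = vertexAt (branch w) <l in u , ∈A⁺ (sym b , ≤-reflexive (sym h))
    ; outer  = let j , j≢ = another 2≤m (branch w)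
                   v , b , _ = vertexAt j (l-pos j)
               in v , (λ v∈ → j≢ (trans (sym b) (sym (proj₁ (∈A⁻ v∈))))) , λ w≡v → j≢ (trans (sym b) (cong branch (sym w≡v)))
    }
    where
    another : ∀ {m} → 2 ≤ m → (i : Fin m) → ∃ λ j → j ≢ i
    another (s≤s (s≤s _)) zero    = suc zero , λ ()
    another (s≤s (s≤s _)) (suc i) = zero , λ ()

  -- From `S` and from its rest one can descend to clique vertices `b` and `c` without meeting `w`.
  -- These are equal or adjacent, so `c` would lie in `S` as well.
  top⇒¬side : ∀ {w} → ¬ suc (height w) < l (branch w) → ¬ ∃ (Side Kₗ w)
  top⇒¬side {w} top (S , s) =
    let x , x∈ = Side.inner s
        y , y∈ = Side.inner s′
        b , hb , b∈ = toClique s (height x) refl x∈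
        c , hc , c∈ = toClique s′ (height y) refl y∈
        c∉S , w≢c = ∈-subset⁻ (outside? w S) c∈
    in c∉S (Side.closed s b c b∈ (clique (λ eq → c∉S (subst (_∈ S) (vertex-≡ eq (trans hb (sym hc))) b∈)) hb hc) w≢c)
    where
    s′ = rest-side Kₗ s
    -- All vertices below a vertex other than w differ from w, because w is the end of its path.
    toClique : ∀ {S} → Side Kₗ w S → ∀ h {u} → height u ≡ h → u ∈ S → ∃ λ b → height b ≡ 0 × b ∈ S
    toClique s zero        hu u∈ = _ , hu , u∈
    toClique s (suc h) {u} hu u∈ with parent u hu
    ... | u′ , b , h′ , u~u′ = toClique s h h′ (Side.closed s u u′ u∈ u~u′ λ { refl →
            top (subst (_< l (branch u′)) (trans hu (cong suc (sym h′))) (subst (λ i → height u < l i) (sym b) (height< u))) })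

  open Sides A w∉A

  -- As `v` is not above `u`, the way to `v` leads down to `u′`. Every separator of `u′` and `v`
  -- also separates `u` and `v`, and `u′` itself is a new one.
  crossings-parent : ∀ {u v u′} → branch u′ ≡ branch u → height u ≡ suc (height u′) →
                     u ≢ v → u′ ≢ v → ¬ Above u v → crossings u′ v < crossings u v
  crossings-parent {u} {v} {u′} b h u≢v u′≢v ¬above = ∑-mono-<
    (λ w → +-mono-≤ (ind-mono (separates? w u′ v) (separates? w u v) (lift w))
                    (ind-mono (separates? w v u′) (separates? w v u) (lift′ w)))
    u′
    (≤-trans (s≤s (≤-reflexive (crossing-self {u′} {u′} {v} (inj₁ refl))))
             (≤-trans (≤-reflexive (sym (ind-true (separates? u′ u v) separates))) (m≤m+n _ _)))
    where
    lift : ∀ w → Separates w u′ v → Separates w u v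
    lift w (u′∈ , o) = let b′ , h′ = ∈A⁻ u′∈ in
      ∈A⁺ (trans b′ b , ≤-trans h′ (≤-trans (n≤1+n _) (≤-reflexive (sym h)))) , o
    lift′ : ∀ w → Separates w v u′ → Separates w v u
    lift′ w (v∈ , u′∉ , w≢u′) = v∈ , u∉ , λ { refl → ¬above (∈A⁻ v∈) }
      where
      u∉ : u ∉ A w
      u∉ u∈ = let b′ , h′ = ∈A⁻ u∈
                  b″ = trans b′ (sym b)
              in u′∉ (∈A⁺ (b″ , ≤∧≢⇒< (s≤s⁻¹ (≤-trans h′ (≤-reflexive h))) λ eq → w≢u′ (vertex-≡ b″ eq)))
    separates : Separates u′ u v
    separates = ∈A⁺ (b , ≤-reflexive (sym h)) , v∉ , u′≢v
      where
      v∉ : v ∉ A u′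
      v∉ v∈ = let b′ , h′ = ∈A⁻ v∈
                  b″ = trans (sym b) b′
              in ¬above (b″ , ≤∧≢⇒< (≤-trans (≤-reflexive h) h′) λ eq → u≢v (vertex-≡ b″ eq))

  -- For distinct vertices the length allowed is exactly the lower bound given by
  -- `crossings<length`.
  ShortWalk : Fin n → Fin n → Set
  ShortWalk u v = ∃ λ k → Walk Kₗ k u v × k ≤ 1 + crossings u v

  shortWalk-sym : ∀ {u v} → ShortWalk u v → ShortWalk v u
  shortWalk-sym {u} {v} (k , p , k≤) =
    k , walk-reverse p , ≤-trans k≤ (≤-reflexive (cong suc (crossings-sym u v)))

  -- Induction on the sum of the heights: an endpoint of positive height with the other not above it
  -- moves to its parent, and two clique vertices are adjacent.
  shortWalk : ∀ {u v} → u ≢ v → ShortWalk u v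
  shortWalk = bounded _ ≤-refl
    where
    bounded : ∀ k {u v} → height u + height v < k → u ≢ v → ShortWalk u v
    descend : ∀ k {u v h} → height u + height v < suc k → height u ≡ suc h → u ≢ v → ¬ Above u v → ShortWalk u v
    descend k {u} {v} {h} <k hu u≢v ¬above with parent u hu
    ... | u′ , b , refl , u~u′ with u′ ≟ᶠ v
    ...   | yes refl = 1 , step u~u′ stay , s≤s z≤n
    ...   | no  u′≢v = let d , p , d≤ = bounded k (s≤s⁻¹ (≤-trans (s≤s (≤-reflexive (cong (_+ height v) (sym hu)))) <k)) u′≢v
                       in suc d , step u~u′ p , s≤s (≤-trans d≤ (crossings-parent b hu u≢v u′≢v ¬above))
    bounded (suc k) {u} {v} <k u≢v = cases (height u) refl (height v) refl
      where
      swapped : height v + height u < suc k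
      swapped = ≤-trans (s≤s (≤-reflexive (+-comm (height v) (height u)))) <k
      cases : ∀ a → height u ≡ a → ∀ b → height v ≡ b → ShortWalk u v
      cases zero    hu zero    hv =
        1 , step (clique (λ b → u≢v (vertex-≡ b (trans hu (sym hv)))) hu hv) stay , s≤s z≤n
      cases zero    hu (suc h) hv =
        shortWalk-sym (descend k swapped hv (u≢v ∘ sym) λ (_ , v<u) → contradiction (subst (height v <_) hu v<u) λ ())
      cases (suc g) hu b       hv with above? u v
      ... | no  ¬above = descend k <k hu u≢v ¬above
      -- Here `v` is above `u`, so the descent starts from `v` instead.
      ... | yes (_ , u<v) with b
      ...   | zero  = contradiction (subst (height u <_) hv u<v) λ ()
      ...   | suc h = shortWalk-sym (descend k swapped hv (u≢v ∘ sym) λ (_ , v<u) → <-asym u<v v<u)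

  connected : Connected Kₗ
  connected u v with u ≟ᶠ v
  ... | yes refl = 0 , stay
  ... | no  u≢v  = let k , p , _ = shortWalk u≢v in k , p

  K∈ℭ : ∀ {s} → n ∸ m ≡ s → Kₗ ∈ℭ s
  K∈ℭ n∸m≡s = record
    { connected       = connected
    ; cutVertices     = cutSet
    ; cutVertices-def = λ v → mk⇔
        (λ v∈ → side⇒cut Kₗ (nonTop⇒side (∈-subset⁻ nonTop? v∈)))
        (λ cut → ∈-subset⁺ nonTop? (decidable-stable (nonTop? v) λ top → top⇒¬side top (cut⇒side Kₗ cut)))
    ; #cutVertices    = trans ∣cutSet∣ n∸m≡s
    }

  wienerIndex-K-≤ : wienerIndex Kₗ connected ≤
                    ∑-< n (λ _ _ → 1) + ∑[ i < m ] ∑[ a < l i ] cutPairs n (toℕ a)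
  wienerIndex-K-≤ = begin
    wienerIndex Kₗ connected
      ≤⟨ ∑-<-mono (λ {u} {v} u≢v → let k , p , k≤ = shortWalk u≢v in
           ≤-trans (proj₂ (proj₂ (distance Kₗ connected u v)) p) k≤) ⟩
    ∑-< n (λ u v → 1 + crossings u v)
      ≡⟨ ∑-crossings ⟩
    ∑-< n (λ _ _ → 1) + ∑[ w < n ] cutPairs n (Subset.∣ A w ∣)
      ≡⟨ cong (∑-< n (λ _ _ → 1) +_) ∑-cutPairs-A ⟩
    ∑-< n (λ _ _ → 1) + ∑[ i < m ] ∑[ a < l i ] cutPairs n (toℕ a) ∎
    where open ≤-Reasoning

-- Nearly equal path lengths and the conclusion.

minimum-entry : ∀ {m} (l : Vector ℕ m) → 1 ≤ m → (∀ i j → ∣ l i - l j ∣ ≤ 1) →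
                ∃ λ i₀ → ∀ i → l i₀ ≤ l i × l i ≤ suc (l i₀)
minimum-entry {suc m} l _ close = choose (any? λ i → l i <? l zero)
  where
  within : ∀ i j → l i ≤ suc (l j)
  within i j = begin
    l i                   ≤⟨ m≤∣m-n∣+n (l i) (l j) ⟩
    ∣ l i - l j ∣ + l j   ≤⟨ +-monoˡ-≤ (l j) (close i j) ⟩
    suc (l j)             ∎
    where open ≤-Reasoning
  choose : Dec (∃ λ i → l i < l zero) → ∃ λ i₀ → ∀ i → l i₀ ≤ l i × l i ≤ suc (l i₀)
  -- An entry below `l zero` is a minimum, because `l zero` exceeds no entry by more than one.
  choose (yes (i₀ , <l₀)) = i₀ , λ i → s≤s⁻¹ (≤-trans <l₀ (within zero i)) , within i i₀
  choose (no none)        = zero , λ i → ≮⇒≥ (λ lt → none (i , lt)) , within i zero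

-- Three paths of at least `q` vertices leave a vertex to spare beyond `q + q`. This places `q` in
-- the range where `cutPairs n` increases, and it is where `s + 3 ≤ n` enters.
twice-minimum≤ : ∀ {m n} (l : Vector ℕ m) {q} → sum l ≡ n → 3 ≤ m → 1 ≤ q → (∀ i → q ≤ l i) → q + q ≤ n ∸ 1
twice-minimum≤ {m} {n} l {q} Σl≡n 3≤m 1≤q q≤l = ∸-monoˡ-≤ 1 (begin
  suc (q + q)       ≤⟨ +-monoˡ-≤ (q + q) 1≤q ⟩
  q + (q + q)       ≡⟨ cong (λ x → q + (q + x)) (+-identityʳ q) ⟨
  3 * q             ≤⟨ *-monoˡ-≤ q 3≤m ⟩
  m * q             ≡⟨ ∑-const m q ⟨
  ∑[ i < m ] q      ≤⟨ ∑-mono-≤ q≤l ⟩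
  sum l             ≡⟨ Σl≡n ⟩
  n ∎)
  where open ≤-Reasoning

theorem1p4 : ∀ (n s : ℕ) → s + 3 ≤ n →
    (l : Vector ℕ (n ∸ s)) → (∀ i → 1 ≤ l i) → (Σl≡n : sum l ≡ n) →
    (∀ i j → ∣ l i - l j ∣ ≤ 1) →
    Σ[ K∈ℭ ∈ (K n l Σl≡n ∈ℭ s) ]
    (∀ (G : Graph (Fin n)) (G∈ℭ : G ∈ℭ s) →
    wienerIndex (K n l Σl≡n) (_∈ℭ_.connected K∈ℭ)
    ≤ wienerIndex G (_∈ℭ_.connected G∈ℭ))
theorem1p4 n s s+3≤n l l-pos Σl≡n close = K∈ℭ (m∸[m∸n]≡n s≤n) , λ G G∈ℭ →
  let open _∈ℭ_ G∈ℭ using (cutVertices; cutVertices-def; #cutVertices)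
                    renaming (connected to G-connected)
  in ≤-trans wienerIndex-K-≤
       (balanced-bound l (l i₀) G G-connected cutVertices Σl≡n (cong (n ∸_) #cutVertices) balanced
         (twice-minimum≤ l Σl≡n 3≤m (l-pos i₀) (proj₁ ∘ balanced))
         (λ {v} → Equivalence.to (cutVertices-def v)))
  where
  s≤n : s ≤ n
  s≤n = m+n≤o⇒m≤o s s+3≤n
  3≤m : 3 ≤ n ∸ s
  3≤m = m+n≤o⇒m≤o∸n 3 (≤-trans (≤-reflexive (+-comm 3 s)) s+3≤n)
  open CliqueWithPaths n l Σl≡n (≤-trans (s≤s (s≤s z≤n)) 3≤m) l-pos
  i₀ = proj₁ (minimum-entry l (≤-trans (s≤s z≤n) 3≤m) close)
  balanced = proj₂ (minimum-entry l (≤-trans (s≤s z≤n) 3≤m) close)
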